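{- Let $k\ge 3$ be an integer and let $(F^{(k)}_n)$ be the $k$-generalized Fibonacci sequence. The triples of integers $(n,d,m)$ with $n\ge 1$, $d\ge 0$, $m\ge 1$ satisfying \[\big(F^{(k)}_n\big)^2+\big(F^{(k)}_{n+d}\big)^2=F^{(k)}_m\] are exactly $(n,d,m)=(1,0,3)$, $(n,d,m)=(1,1,3)$, and $(n,d,m)=(a,0,2a-1)$ for integers $a$ with $2\le a\le \lfloor (k+2)/2\rfloor$.
   Context: For an integer $k\ge 2$, the $k$-generalized Fibonacci sequence $(F^{(k)}_n)_{n\ge -(k-2)}$ is defined by $F^{(k)}_{ -k+2}=\cdots=F^{(k)}_0=0$, $F^{(k)}_1=1$, and $F^{(k)}_{n+k}=F^{(k)}_{n+k-1}+F^{(k)}_{n+k-2}+\cdots+F^{(k)}_n$ for $n\ge 0$. -}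

module Defs where

open import Data.Nat using (ℕ; zero; suc; _+_; _∸_)
open import Data.List using (List; []; _∷_; take; replicate)
open import Data.Nat.ListAction using (sum)

-- window k n = [F⁽ᵏ⁾ₙ, F⁽ᵏ⁾ₙ₋₁, …, F⁽ᵏ⁾ₙ₋ₖ₊₁]  (k entries, for n ≥ 0,
-- with the initial values F⁽ᵏ⁾_{-(k-2)} = … = F⁽ᵏ⁾_0 = 0, F⁽ᵏ⁾_1 = 1)
window : ℕ → ℕ → List ℕ
window k zero = replicate k 0
window k (suc zero) = 1 ∷ replicate (k ∸ 1) 0
window k (suc (suc n)) = sum (window k (suc n)) ∷ take (k ∸ 1) (window k (suc n))

headOr0 : List ℕ → ℕ
headOr0 [] = 0
headOr0 (x ∷ _) = x

-- F k n = F⁽ᵏ⁾ₙ for n ≥ 0 (meaningful for k ≥ 2)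
F : ℕ → ℕ → ℕ
F k n = headOr0 (window k n)

{-# OPTIONS --safe #-}

-- Write c a = F k (suc a), the number of compositions of a with parts ≤ k.
-- Splitting a composition of a + b at position a gives, for k ≥ 3,
--   c a * c b + c (a - 1) * (c (b - 1) + c (b - 2)) ≤ c (a + b) ≤ c a * c (b + 1)
-- (with c = 0 at negative arguments).  Hence c p ² + c q ² lies strictly between
-- c (2 p - 1) and c (2 p) when q < p and p ≥ 2, while 2 * c p ² lies in
-- [c (2 p), c (2 p + 1)) when p ≥ 1, the left end being attained iff 2 p ≤ k.
module Submission where

open import Defs
open import Data.Nat using (ℕ; _+_; _*_; _∸_; _≤_; _≥_; _/_)
open import Data.Nat using (zero; suc; pred; _⊓_; _<_; z≤n; s≤s; >-nonZero)
open import Data.Nat.Properties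
open import Data.Nat.DivMod using (/-mono-≤; m*n/n≡m; m/n*n≤m)
open import Data.Nat.Induction using (<-rec)
open import Data.Nat.ListAction using (sum)
open import Data.Nat.Tactic.RingSolver using (solve-∀)
open import Data.List using (take; replicate; length)
open import Data.List.Properties
  using (take-all; take-take; length-replicate; length-take)
open import Data.Product using (_×_; Σ-syntax; _,_)
open import Data.Sum using (_⊎_; inj₁; inj₂)
open import Relation.Binary.PropositionalEquality
  using (_≡_; refl; sym; trans; cong; cong₂; subst; module ≡-Reasoning)
open import Relation.Binary.Definitions using (tri<; tri≈; tri>)
open import Relation.Nullary using (¬_; yes; no; contradiction)
open import Function using (_∘_)
open import Function.Bundles using (_⇔_; mk⇔)

-- Sums of consecutive terms, taken backwards and cut off at index 0

-- f m + f (m - 1) + …, stopping after j terms or at f 0.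
sumLast : (ℕ → ℕ) → ℕ → ℕ → ℕ
sumLast f zero    _       = 0
sumLast f (suc j) zero    = f 0
sumLast f (suc j) (suc m) = f (suc m) + sumLast f j m

sumLast-mono-≤ : ∀ {f g} j m → (∀ i → i ≤ m → f i ≤ g i) →
  sumLast f j m ≤ sumLast g j m
sumLast-mono-≤ zero    m       h = z≤n
sumLast-mono-≤ (suc j) zero    h = h 0 z≤n
sumLast-mono-≤ (suc j) (suc m) h =
  +-mono-≤ (h (suc m) ≤-refl) (sumLast-mono-≤ j m (λ i i≤m → h i (m≤n⇒m≤1+n i≤m)))

sumLast-linear : ∀ f g x y j m →
  sumLast (λ i → f i * x + g i * y) j m ≡ sumLast f j m * x + sumLast g j m * y
sumLast-linear f g x y zero    m       = refl
sumLast-linear f g x y (suc j) zero    = refl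
sumLast-linear f g x y (suc j) (suc m) =
  trans (cong (f (suc m) * x + g (suc m) * y +_) (sumLast-linear f g x y j m))
        (interchange (f (suc m)) (g (suc m)) (sumLast f j m) (sumLast g j m) x y)
  where
  interchange : ∀ a b c d x y → a * x + b * y + (c * x + d * y) ≡ (a + c) * x + (b + d) * y
  interchange = solve-∀

sumLast-scale : ∀ f x j m → sumLast (λ i → f i * x) j m ≡ sumLast f j m * x
sumLast-scale f x zero    m       = refl
sumLast-scale f x (suc j) zero    = refl
sumLast-scale f x (suc j) (suc m) =
  trans (cong (f (suc m) * x +_) (sumLast-scale f x j m))
        (sym (*-distribʳ-+ x (f (suc m)) (sumLast f j m)))

head≤sumLast : ∀ f j m → f m ≤ sumLast f (suc j) m
head≤sumLast f j zero    = ≤-refl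
head≤sumLast f j (suc m) = m≤m+n _ _

-- The left sum is cut off at `f b`, while the right one may go on below `b`.
sumLast-shift-≤ : ∀ f b j m → sumLast (λ i → f (i + b)) j m ≤ sumLast f j (m + b)
sumLast-shift-≤ f b zero    m       = z≤n
sumLast-shift-≤ f b (suc j) zero    = head≤sumLast f j b
sumLast-shift-≤ f b (suc j) (suc m) = +-monoʳ-≤ _ (sumLast-shift-≤ f b j m)

-- The bound on `j` ensures that neither sum is cut short: both have exactly `j` terms.
sumLast-shift : ∀ f b j m → j ≤ suc m →
  sumLast (λ i → f (i + b)) j m ≡ sumLast f j (m + b)
sumLast-shift f b zero          m       _         = refl
sumLast-shift f zero    (suc zero) zero _         = refl
sumLast-shift f (suc b) (suc zero) zero _         = sym (+-identityʳ _)
sumLast-shift f b (suc (suc j)) zero    (s≤s ())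
sumLast-shift f b (suc j)       (suc m) (s≤s j≤m) =
  cong (f (suc m + b) +_) (sumLast-shift f b j m j≤m)

sumLast-suc : ∀ f → f 0 ≡ 0 → ∀ j m → sumLast (f ∘ suc) j m ≡ sumLast f j (suc m)
sumLast-suc f f0 zero          m       = refl
sumLast-suc f f0 (suc zero)    zero    = sym (+-identityʳ _)
sumLast-suc f f0 (suc (suc j)) zero    = sym (trans (cong (f 1 +_) f0) (+-identityʳ _))
sumLast-suc f f0 (suc j)       (suc m) = cong (f (suc (suc m)) +_) (sumLast-suc f f0 j m)

sumLast-≤-suc : ∀ f j m → sumLast f j m ≤ sumLast f (suc j) m
sumLast-≤-suc f zero    m       = z≤n
sumLast-≤-suc f (suc j) zero    = ≤-refl
sumLast-≤-suc f (suc j) (suc m) = +-monoʳ-≤ _ (sumLast-≤-suc f j m)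

sumLast-saturated : ∀ f j m → m < j → sumLast f (suc j) m ≡ sumLast f j m
sumLast-saturated f (suc j) zero    _         = refl
sumLast-saturated f (suc j) (suc m) (s≤s m<j) = cong (f (suc m) +_) (sumLast-saturated f j m m<j)

sumLast-<-suc : ∀ f → (∀ i → 0 < f i) → ∀ j m → j ≤ m → sumLast f j m < sumLast f (suc j) m
sumLast-<-suc f pos zero    m       _         = <-≤-trans (pos m) (head≤sumLast f 0 m)
sumLast-<-suc f pos (suc j) (suc m) (s≤s j≤m) = +-monoʳ-< _ (sumLast-<-suc f pos j m j≤m)

-- From windows to the recurrence

sum-take-zeros : ∀ j n → sum (take j (replicate n 0)) ≡ 0
sum-take-zeros zero    n       = refl
sum-take-zeros (suc j) zero    = refl
sum-take-zeros (suc j) (suc n) = sum-take-zeros j n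

sumLast-zero : ∀ f → f 0 ≡ 0 → ∀ j → sumLast f j 0 ≡ 0
sumLast-zero f f0 zero    = refl
sumLast-zero f f0 (suc j) = f0

length-window : ∀ k n → length (window (suc k) n) ≡ suc k
length-window k zero          = cong suc (length-replicate k)
length-window k (suc zero)    = cong suc (length-replicate k)
length-window k (suc (suc n)) = cong suc
  (trans (length-take k (window (suc k) (suc n)))
  (trans (cong (k ⊓_) (length-window k (suc n))) (m≤n⇒m⊓n≡m (n≤1+n k))))

-- Stated for every prefix length `j` so that the induction closes: the tail of a window is a
-- shorter prefix of the previous window. Terms at negative indices are zeros, which `sumLast`
-- omits.
sum-take-window : ∀ k j n → j ≤ suc k →
  sum (take j (window (suc k) n)) ≡ sumLast (F (suc k)) j n
sum-take-window k j             zero          _         =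
  trans (sum-take-zeros j (suc k)) (sym (sumLast-zero (F (suc k)) refl j))
sum-take-window k zero          (suc n)       _         = refl
sum-take-window k (suc j)       (suc zero)    _         = cong suc
  (trans (sum-take-zeros j k) (sym (sumLast-zero (F (suc k)) refl j)))
sum-take-window k (suc j)       (suc (suc n)) (s≤s j≤k) = cong (F (suc k) (suc (suc n)) +_)
  (trans (cong sum (trans (take-take j k (window (suc k) (suc n)))
                          (cong (λ i → take i (window (suc k) (suc n))) (m≤n⇒m⊓n≡m j≤k))))
         (sum-take-window k j (suc n) (m≤n⇒m≤1+n j≤k)))

F-rec : ∀ k n → F (suc k) (suc (suc n)) ≡ sumLast (F (suc k)) (suc k) (suc n)
F-rec k n =
  trans (cong sum (sym (take-all (suc k) (window (suc k) (suc n))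
                                 (≤-reflexive (length-window k (suc n))))))
        (sum-take-window k (suc k) (suc n) ≤-refl)

-- Recurrence and monotonicity of `c`

module Compositions (l : ℕ) where

  k : ℕ
  k = suc (suc (suc l))

  f c : ℕ → ℕ
  f = F k
  c a = f (suc a)

  c-rec : ∀ a → c (suc a) ≡ sumLast c k a
  c-rec a = trans (F-rec (suc (suc l)) a) (sym (sumLast-suc f refl k a))

  c1≡1 : c 1 ≡ 1
  c1≡1 = c-rec 0

  c2≡2 : c 2 ≡ 2
  c2≡2 = trans (c-rec 1) (cong (_+ 1) c1≡1)

  c-step : ∀ a → c a ≤ c (suc a)
  c-step a = ≤-trans (head≤sumLast c (suc (suc l)) a) (≤-reflexive (sym (c-rec a)))

  c-pos : ∀ a → 0 < c a
  c-pos zero    = s≤s z≤n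
  c-pos (suc a) = ≤-trans (c-pos a) (c-step a)

  c-mono : ∀ {a b} → a ≤ b → c a ≤ c b
  c-mono {zero}  {zero}  _ = ≤-refl
  c-mono {a}     {suc b} a≤1+b with m≤n⇒m<n∨m≡n a≤1+b
  ... | inj₁ (s≤s a≤b) = ≤-trans (c-mono a≤b) (c-step b)
  ... | inj₂ refl      = ≤-refl

  -- This is where `k ≥ 3` enters: the recurrence contains at least three terms. Here `f b` and
  -- `f (pred b)` stand for `c (b - 1)` and `c (b - 2)`; the value `f 0 = 0` serves for negative
  -- arguments.
  three-terms : ∀ b → c b + (f b + f (pred b)) ≤ c (suc b)
  three-terms zero          = ≤-reflexive (sym c1≡1)
  three-terms (suc zero)    = ≤-reflexive (trans (cong (_+ 1) c1≡1) (sym c2≡2))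
  three-terms (suc (suc b)) = ≤-trans
    (+-monoʳ-≤ (c (suc (suc b))) (+-monoʳ-≤ (c (suc b)) (head≤sumLast c l b)))
    (≤-reflexive (sym (c-rec (suc (suc b)))))

  c-step-< : ∀ a → c (suc a) < c (suc (suc a))
  c-step-< a = <-≤-trans (m<m+n (c (suc a)) (≤-trans (c-pos a) (m≤m+n _ _)))
                         (three-terms (suc a))

  -- The target starts at 2 because `c 0 = c 1 = 1`.
  c-mono-< : ∀ {a b} → a < suc (suc b) → c a < c (suc (suc b))
  c-mono-< {a} {b} (s≤s a≤1+b) = ≤-<-trans (c-mono a≤1+b) (c-step-< b)

  c-cancel-< : ∀ {a b} → c a < c b → a < b
  c-cancel-< ca<cb = ≰⇒> λ b≤a → <⇒≱ ca<cb (c-mono b≤a)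

  c-injective : ∀ {a b} → c a ≡ c (suc (suc b)) → a ≡ suc (suc b)
  c-injective {a} {b} eq with <-cmp a (suc (suc b))
  ... | tri< a<2+b _ _ = contradiction eq (<⇒≢ (c-mono-< a<2+b))
  ... | tri≈ _ a≡2+b _ = a≡2+b
  c-injective {suc (suc a)} eq | tri> _ _ 2+b<a = contradiction (sym eq) (<⇒≢ (c-mono-< 2+b<a))
  c-injective {suc zero}    eq | tri> _ _ (s≤s ())

  -- Doubling: exact below `k`, strict beyond

  double : ℕ → ℕ
  double x = x + x

  -- After its leading `c (suc a)`, the recurrence for `c (suc (suc a))` sums `k - 1` terms from
  -- `c a` down; `c (suc a)` itself sums `k` of them. The next two lemmas depend on whether the last
  -- of these terms exists.
  c-double-≤ : ∀ a → c (suc (suc a)) ≤ double (c (suc a))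
  c-double-≤ a = begin
    c (suc (suc a))                             ≡⟨ c-rec (suc a) ⟩
    c (suc a) + sumLast c (suc (suc l)) a       ≤⟨ +-monoʳ-≤ _ (sumLast-≤-suc c (suc (suc l)) a) ⟩
    c (suc a) + sumLast c k a                   ≡⟨ cong (c (suc a) +_) (sym (c-rec a)) ⟩
    double (c (suc a))                          ∎
    where open ≤-Reasoning

  c-double-< : ∀ a → k ≤ suc a → c (suc (suc a)) < double (c (suc a))
  c-double-< a (s≤s k≤a) = begin-strict
    c (suc (suc a))                             ≡⟨ c-rec (suc a) ⟩
    c (suc a) + sumLast c (suc (suc l)) a       <⟨ +-monoʳ-< _ (sumLast-<-suc c c-pos (suc (suc l)) a k≤a) ⟩
    c (suc a) + sumLast c k a                   ≡⟨ cong (c (suc a) +_) (sym (c-rec a)) ⟩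
    double (c (suc a))                          ∎
    where open ≤-Reasoning

  c-double-≡ : ∀ a → suc a < k → c (suc (suc a)) ≡ double (c (suc a))
  c-double-≡ a (s≤s a<k) = trans (c-rec (suc a)) (cong (c (suc a) +_)
    (trans (sym (sumLast-saturated c (suc (suc l)) a a<k)) (sym (c-rec a))))

  -- Bounds for `c (a + b)` by products

  -- The first product counts compositions with a cut at position `a`; the second counts those where
  -- a part of length 2 or 3 starts at `a - 1` and straddles it. For fixed `b` the bound is linear
  -- in `c a` and `f a`, so it obeys the same recurrence.
  c-+-lower : ∀ a b → c a * c b + f a * (f b + f (pred b)) ≤ c (a + b)
  c-+-lower a b = <-rec (λ a → bound a ≤ c (a + b)) step a
    where
    open ≤-Reasoning
    bound : ℕ → ℕ
    bound a = c a * c b + f a * (f b + f (pred b))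
    step : ∀ a → (∀ {i} → i < a → bound i ≤ c (i + b)) → bound a ≤ c (a + b)
    step zero          _  = ≤-reflexive (trans (+-identityʳ _) (*-identityˡ _))
    -- A second base case is needed because `f` obeys the recurrence only from index 2 on.
    step (suc zero)    _  = ≤-trans
      (≤-reflexive (cong₂ _+_ (trans (cong (_* c b) c1≡1) (*-identityˡ _)) (*-identityˡ _)))
      (three-terms b)
    step (suc (suc a)) ih = begin
      bound (suc (suc a))
        ≡⟨ cong₂ (λ x y → x * c b + y * (f b + f (pred b))) (c-rec (suc a)) (F-rec (suc (suc l)) a) ⟩
      sumLast c k (suc a) * c b + sumLast f k (suc a) * (f b + f (pred b))
        ≡⟨ sym (sumLast-linear c f (c b) _ k (suc a)) ⟩
      sumLast bound k (suc a)
        ≤⟨ sumLast-mono-≤ k (suc a) (λ i i≤a → ih (s≤s i≤a)) ⟩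
      sumLast (λ i → c (i + b)) k (suc a)
        ≤⟨ sumLast-shift-≤ c b k (suc a) ⟩
      sumLast c k (suc a + b)
        ≡⟨ sym (c-rec (suc a + b)) ⟩
      c (suc (suc a) + b) ∎

  -- The sums compared in the last case must not be truncated at index 0, hence
  -- the separate case a < k, where c (a + 1) is exactly 2 * c a.
  c-+-upper : ∀ a b → c (a + b) ≤ c a * c (suc b)
  c-+-upper a b = <-rec (λ a → c (a + b) ≤ c a * c (suc b)) step a
    where
    open ≤-Reasoning
    step : ∀ a → (∀ {i} → i < a → c (i + b) ≤ c i * c (suc b)) → c (a + b) ≤ c a * c (suc b)
    step zero          _  = ≤-trans (c-step b) (≤-reflexive (sym (*-identityˡ _)))
    step (suc zero)    _  =
      ≤-reflexive (sym (trans (cong (_* c (suc b)) c1≡1) (*-identityˡ _)))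
    step (suc (suc a)) ih with suc a <? k
    ... | yes a<k = begin
      c (suc (suc a) + b)                        ≤⟨ c-double-≤ (a + b) ⟩
      double (c (suc a + b))                     ≤⟨ +-mono-≤ (ih ≤-refl) (ih ≤-refl) ⟩
      double (c (suc a) * c (suc b))             ≡⟨ sym (*-distribʳ-+ (c (suc b)) (c (suc a)) _) ⟩
      double (c (suc a)) * c (suc b)             ≡⟨ cong (_* c (suc b)) (sym (c-double-≡ a a<k)) ⟩
      c (suc (suc a)) * c (suc b)                ∎
    ... | no  a≮k = begin
      c (suc (suc a) + b)                        ≡⟨ c-rec (suc a + b) ⟩
      sumLast c k (suc a + b)                    ≡⟨ sym (sumLast-shift c b k (suc a) (m≤n⇒m≤1+n (≮⇒≥ a≮k))) ⟩
      sumLast (λ i → c (i + b)) k (suc a)        ≤⟨ sumLast-mono-≤ k (suc a) (λ i i≤a → ih (s≤s i≤a)) ⟩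
      sumLast (λ i → c i * c (suc b)) k (suc a)  ≡⟨ sumLast-scale c (c (suc b)) k (suc a) ⟩
      sumLast c k (suc a) * c (suc b)            ≡⟨ cong (_* c (suc b)) (sym (c-rec (suc a))) ⟩
      c (suc (suc a)) * c (suc b)                ∎

  -- In this range `c (suc i)` is the power of two with exponent `i`, since no part can exceed `k`.
  c-+-exact : ∀ a b → suc a + b ≤ k → c (suc a + b) ≡ c (suc a) * c (suc b)
  c-+-exact zero    b _ = sym (trans (cong (_* c (suc b)) c1≡1) (*-identityˡ _))
  c-+-exact (suc a) b h = begin
    c (suc (suc a) + b)              ≡⟨ c-double-≡ (a + b) h ⟩
    double (c (suc a + b))           ≡⟨ cong double (c-+-exact a b (<⇒≤ h)) ⟩
    double (c (suc a) * c (suc b))   ≡⟨ sym (*-distribʳ-+ (c (suc b)) (c (suc a)) _) ⟩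
    double (c (suc a)) * c (suc b)   ≡⟨ cong (_* c (suc b)) (sym (c-double-≡ a (≤-trans (s≤s (s≤s (m≤m+n a b))) h))) ⟩
    c (suc (suc a)) * c (suc b)      ∎
    where open ≡-Reasoning

  -- The last doubling is strict on the left, where the index has passed `k`, but still exact for
  -- the factor on the right.
  c-+-strict : ∀ a b → suc a < k → k < suc (suc a) + b →
    c (suc (suc a) + b) < c (suc (suc a)) * c (suc b)
  c-+-strict a b a<k (s≤s k≤a+b) = begin-strict
    c (suc (suc a) + b)              <⟨ c-double-< (a + b) k≤a+b ⟩
    double (c (suc a + b))           ≤⟨ +-mono-≤ (c-+-upper (suc a) b) (c-+-upper (suc a) b) ⟩
    double (c (suc a) * c (suc b))   ≡⟨ sym (*-distribʳ-+ (c (suc b)) (c (suc a)) _) ⟩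
    double (c (suc a)) * c (suc b)   ≡⟨ cong (_* c (suc b)) (sym (c-double-≡ a a<k)) ⟩
    c (suc (suc a)) * c (suc b)      ∎
    where open ≤-Reasoning

  -- Twice a square

  c-*-double : ∀ a → c a * double (c a) ≡ double (c a * c a)
  c-*-double a = *-distribˡ-+ (c a) (c a) (c a)

  c-twice-≤ : ∀ a → c (suc a + suc a) ≤ double (c (suc a) * c (suc a))
  c-twice-≤ a = ≤-trans (c-+-upper (suc a) (suc a))
    (≤-trans (*-monoʳ-≤ (c (suc a)) (c-double-≤ a)) (≤-reflexive (c-*-double (suc a))))

  c-twice-≡ : ∀ a → suc a + suc a ≤ k → double (c (suc a) * c (suc a)) ≡ c (suc a + suc a)
  c-twice-≡ a h = sym (trans (c-+-exact a (suc a) h)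
    (trans (cong (c (suc a) *_) (c-double-≡ a (≤-trans (s≤s (m≤n+m (suc a) a)) h)))
           (c-*-double (suc a))))

  -- Of the two inequalities composed in `c-twice-≤`, at least one is strict: the product bound if
  -- `suc a < k`, the doubling bound otherwise.
  c-twice-< : ∀ a → k < suc a + suc a → c (suc a + suc a) < double (c (suc a) * c (suc a))
  c-twice-< zero    (s≤s (s≤s ()))
  c-twice-< (suc a) h with suc a <? k
  ... | yes a<k = <-≤-trans (c-+-strict a (suc (suc a)) a<k h)
    (≤-trans (*-monoʳ-≤ (c (suc (suc a))) (c-double-≤ (suc a)))
             (≤-reflexive (c-*-double (suc (suc a)))))
  ... | no  a≮k = ≤-<-trans (c-+-upper (suc (suc a)) (suc (suc a)))
    (<-≤-trans (*-monoʳ-< (c (suc (suc a))) {{>-nonZero (c-pos (suc (suc a)))}}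
                 (c-double-< (suc a) (m≤n⇒m≤1+n (≮⇒≥ a≮k))))
               (≤-reflexive (c-*-double (suc (suc a)))))

  -- This is `twice-<-c` with the common factor `c (suc a)` removed.
  double<three-terms : ∀ a →
    double (c (suc a)) < c (suc (suc a)) + (f (suc a) + f a)
  double<three-terms zero    = begin-strict
    double (c 1)    ≡⟨ cong double c1≡1 ⟩
    2               <⟨ n<1+n 2 ⟩
    2 + 1           ≡⟨ cong (_+ 1) (sym c2≡2) ⟩
    c 2 + 1         ∎
    where open ≤-Reasoning
  double<three-terms (suc a) = begin-strict
    c (2 + a) + c (2 + a)               ≤⟨ +-monoʳ-≤ (c (2 + a)) (c-double-≤ a) ⟩
    c (2 + a) + (c (1 + a) + c (1 + a)) ≡⟨ sym (+-assoc (c (2 + a)) _ _) ⟩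
    c (2 + a) + c (1 + a) + c (1 + a)   <⟨ +-mono-<-≤ (+-monoʳ-< (c (2 + a)) (m<m+n (c (1 + a)) (c-pos a)))
                                                      (m≤m+n (c (1 + a)) (c a)) ⟩
    c (2 + a) + (c (1 + a) + c a) + (c (1 + a) + c a)
                                        ≤⟨ +-monoˡ-≤ _ (three-terms (2 + a)) ⟩
    c (3 + a) + (c (1 + a) + c a)       ∎
    where open ≤-Reasoning

  -- Splitting the index unevenly as `(a + 2) + (a + 1)` makes `c (suc a)` a factor of both products
  -- in `c-+-lower`, since `f (a + 2)` is `c (a + 1)`.
  twice-<-c : ∀ a → double (c (suc a) * c (suc a)) < c (suc (suc a + suc a))
  twice-<-c a = begin-strict
    double (c (suc a) * c (suc a))
      ≡⟨ sym (c-*-double (suc a)) ⟩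
    c (suc a) * double (c (suc a))
      <⟨ *-monoʳ-< (c (suc a)) {{>-nonZero (c-pos (suc a))}} (double<three-terms a) ⟩
    c (suc a) * (c (suc (suc a)) + (f (suc a) + f a))
      ≡⟨ trans (*-distribˡ-+ (c (suc a)) (c (suc (suc a))) _)
               (cong (_+ c (suc a) * (f (suc a) + f a)) (*-comm (c (suc a)) _)) ⟩
    c (suc (suc a)) * c (suc a) + c (suc a) * (f (suc a) + f a)
      ≤⟨ c-+-lower (suc (suc a)) (suc a) ⟩
    c (suc (suc a + suc a)) ∎
    where open ≤-Reasoning

  -- Two distinct squares

  -- With `p = 2 + a`, the straddling term of `c-+-lower p p` exceeds the square of `c (p - 1)`
  -- because `c (p - 2)` is positive. For `p = 1` this fails: `c 0` and `c 1` give the sporadic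
  -- solution with `d = 1`.
  squares-<-c : ∀ a q → q ≤ suc a →
    c q * c q + c (2 + a) * c (2 + a) < c ((2 + a) + (2 + a))
  squares-<-c a q q≤1+a = begin-strict
    c q * c q + c (2 + a) * c (2 + a)
      ≡⟨ +-comm (c q * c q) _ ⟩
    c (2 + a) * c (2 + a) + c q * c q
      ≤⟨ +-monoʳ-≤ (c (2 + a) * c (2 + a)) (*-monoʳ-≤ (c q) (c-mono q≤1+a)) ⟩
    c (2 + a) * c (2 + a) + c q * c (1 + a)
      ≤⟨ +-monoʳ-≤ (c (2 + a) * c (2 + a)) (*-monoˡ-≤ (c (1 + a)) (c-mono q≤1+a)) ⟩
    c (2 + a) * c (2 + a) + c (1 + a) * c (1 + a)
      <⟨ +-monoʳ-< (c (2 + a) * c (2 + a))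
           (*-monoʳ-< (c (1 + a)) {{>-nonZero (c-pos (1 + a))}} (m<m+n (c (1 + a)) (c-pos a))) ⟩
    c (2 + a) * c (2 + a) + c (1 + a) * (c (1 + a) + c a)
      ≤⟨ c-+-lower (2 + a) (2 + a) ⟩
    c ((2 + a) + (2 + a)) ∎
    where open ≤-Reasoning

  c-<-squares : ∀ a q → c (suc a + a) < c q * c q + c (suc a) * c (suc a)
  c-<-squares a q = ≤-<-trans (c-+-upper (suc a) a)
    (m<n+m (c (suc a) * c (suc a)) (*-mono-≤ (c-pos q) (c-pos q)))

  -- Locating the index of the sum

  equal-squares : ∀ a b → double (c (suc a) * c (suc a)) ≡ c b →
    b ≡ suc a + suc a × suc a + suc a ≤ k
  equal-squares a b eq = b≡ , ≮⇒≥ λ k< →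
      <⇒≢ (c-twice-< a k<) (sym (trans eq (cong c b≡)))
    where
    upper : b < suc (suc a + suc a)
    upper = c-cancel-< (subst (_< c (suc (suc a + suc a))) eq (twice-<-c a))
    b≡ : b ≡ suc a + suc a
    b≡ with m≤n⇒m<n∨m≡n upper
    ... | inj₂ e = suc-injective e
    -- A smaller `b` would give `c b < c (suc a + suc a)`; `+-suc` exposes the two successors that
    -- `c-mono-<` asks for.
    ... | inj₁ (s≤s b<) = contradiction (subst (λ x → c b < c x) (sym (cong suc (+-suc a a)))
            (c-mono-< (subst (b <_) (cong suc (+-suc a a)) b<)))
            (≤⇒≯ (subst (c (suc a + suc a) ≤_) eq (c-twice-≤ a)))

  -- With `p = 2 + a`, the index `b` would lie strictly between `2 p - 1` and `2 p`.
  distinct-squares : ∀ a q b → q ≤ suc a → ¬ (c q * c q + c (2 + a) * c (2 + a) ≡ c b)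
  distinct-squares a q b q≤ eq = <⇒≱ lower (≤-pred (≤-trans upper (≤-reflexive (+-suc (2 + a) (1 + a)))))
    where
    lower : (2 + a) + (1 + a) < b
    lower = c-cancel-< (subst (c ((2 + a) + (1 + a)) <_) eq (c-<-squares (suc a) q))
    upper : b < (2 + a) + (2 + a)
    upper = c-cancel-< (subst (_< c ((2 + a) + (2 + a))) eq (squares-<-c a q q≤))

  -- Translation to the indices of `F`

  Solution : ℕ → ℕ → ℕ → Set
  Solution n d m = (n ≡ 1 × d ≡ 0 × m ≡ 3) ⊎ (n ≡ 1 × d ≡ 1 × m ≡ 3)
    ⊎ (Σ[ a ∈ ℕ ] (2 ≤ a × a ≤ (k + 2) / 2 × n ≡ a × d ≡ 0 × m ≡ 2 * a ∸ 1))

  suc-+-suc : ∀ a → suc (suc a + suc a) ≡ 2 * suc (suc a) ∸ 1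
  suc-+-suc a = lemma a
    where
    -- The right side is what `2 * suc (suc a) ∸ 1` computes to, so the solver meets no truncated
    -- subtraction.
    lemma : ∀ a → suc (suc a + suc a) ≡ suc (a + suc (suc (a + 0)))
    lemma = solve-∀

  half-bound : ∀ a → suc a + suc a ≤ k → suc (suc a) ≤ (k + 2) / 2
  half-bound a h = subst (_≤ (k + 2) / 2) (m*n/n≡m (suc (suc a)) 2)
    (/-mono-≤ (≤-trans (≤-reflexive (lemma a)) (+-monoˡ-≤ 2 h)) (≤-refl {2}))
    where
    lemma : ∀ a → suc (suc a) * 2 ≡ suc a + suc a + 2
    lemma = solve-∀

  half-bound⁻¹ : ∀ a → suc (suc a) ≤ (k + 2) / 2 → suc a + suc a ≤ k
  half-bound⁻¹ a h = +-cancelʳ-≤ 2 (suc a + suc a) k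
    (≤-trans (≤-reflexive (lemma a)) (≤-trans (*-monoˡ-≤ 2 h) (m/n*n≤m (k + 2) 2)))
    where
    lemma : ∀ a → suc a + suc a + 2 ≡ suc (suc a) * 2
    lemma = solve-∀

  solve-equation : ∀ n d b →
    c n * c n + c (n + d) * c (n + d) ≡ c b → Solution (suc n) d (suc b)
  -- Both squares are 1, so `c b = 2 = c 2`.
  solve-equation zero zero b eq =
    inj₁ (refl , refl , cong suc (c-injective (trans (sym eq) (sym c2≡2))))
  solve-equation (suc n) zero b eq
    with equal-squares n b (subst (λ i → c (suc n) * c (suc n) + c i * c i ≡ c b) (+-identityʳ (suc n)) eq)
  -- The witness is one more than the index `suc n` of `c`, as `c` lags `F` by one.
  ... | b≡ , bound = inj₂ (inj₂ (suc (suc n) , s≤s (s≤s z≤n) , half-bound n bound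
    , refl , refl , trans (cong suc b≡) (suc-+-suc n)))
  solve-equation zero (suc zero) b eq = inj₂ (inj₁ (refl , refl ,
    cong suc (c-injective (trans (sym eq) (trans (cong (λ x → 1 + x * x) c1≡1) (sym c2≡2))))))
  solve-equation zero (suc (suc d)) b eq = contradiction eq (distinct-squares d 0 b z≤n)
  solve-equation (suc n) (suc d) b eq = contradiction
    (subst (λ i → c (suc n) * c (suc n) + c i * c i ≡ c b) (cong suc (+-suc n d)) eq)
    (distinct-squares (n + d) (suc n) b (s≤s (m≤m+n n d)))

  check-solution : ∀ n d m → Solution n d m → f n * f n + f (n + d) * f (n + d) ≡ f m
  check-solution n d m (inj₁ (refl , refl , refl)) = sym c2≡2
  check-solution n d m (inj₂ (inj₁ (refl , refl , refl))) =
    trans (cong (λ x → 1 + x * x) c1≡1) (sym c2≡2)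
  check-solution n d m (inj₂ (inj₂ (suc (suc a) , s≤s (s≤s _) , h , refl , refl , refl))) =
    trans (cong (λ i → c (suc a) * c (suc a) + c i * c i) (+-identityʳ (suc a)))
          (trans (c-twice-≡ a (half-bound⁻¹ a h)) (cong f (suc-+-suc a)))

theorem3p4 : (k : ℕ) → k ≥ 3 → (n d m : ℕ) → n ≥ 1 → m ≥ 1 →
    ((F k n * F k n + F k (n + d) * F k (n + d) ≡ F k m) ⇔
    ((n ≡ 1 × d ≡ 0 × m ≡ 3) ⊎ (n ≡ 1 × d ≡ 1 × m ≡ 3)
    ⊎ (Σ[ a ∈ ℕ ] (2 ≤ a × a ≤ (k + 2) / 2 × n ≡ a × d ≡ 0 × m ≡ 2 * a ∸ 1))))
theorem3p4 (suc (suc (suc l))) _ (suc n) d (suc m) _ _ =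
  mk⇔ (solve-equation n d m) (check-solution (suc n) d (suc m))
  where open Compositions l
theorem3p4 (suc zero) (s≤s ()) _ _ _ _ _
theorem3p4 (suc (suc zero)) (s≤s (s≤s ())) _ _ _ _ _
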